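{- Let $k$ be a positive integer. If the problem $\mathrm{GPCP}(k+2)$ is decidable on erasement-free instances, then the problem $\mathrm{ACCESSIBILITY}(k)$ is decidable.
   Context: An alphabet is a finite set of letters; $\Sigma^\star$ is the set of all words over $\Sigma$, including the empty word $\varepsilon$, and $\Sigma^+ = \Sigma^\star \setminus \{\varepsilon\}$. A morphism $\sigma:\Sigma^\star\to\Delta^\star$ is a map with $\sigma(xy)=\sigma(x)\sigma(y)$ for all $x,y\in\Sigma^\star$; it is finitely encoded by its restriction to $\Sigma$. $\mathrm{GPCP}$ (Generalized Post Correspondence Problem): given an alphabet $\Sigma$, two morphisms $\sigma,\tau:\Sigma^\star\to\{0,1\}^\star$ and four words $s,t,s',t'\in\{0,1\}^\star$ (the instance being $(\Sigma,\sigma,\tau,s,t,s',t')$), decide whether there exists $w\in\Sigma^\star$ such that $s\,\sigma(w)\,t=s'\,\tau(w)\,t'$. For an integer $k\ge1$, $\mathrm{GPCP}(k)$ is the restriction to instances with $\Sigma$ of cardinality $k$. An instance of $\mathrm{GPCP}$ is erasement-free if $\sigma(a)\neq\varepsilon$ and $\tau(a)\ne\varepsilon$ for every letter $a\in\Sigma$. A semi-Thue system is a pair $T=(\Sigma,R)$ with $\Sigma$ an alphabet and $R\subseteq\Sigma^\star\times\Sigma^\star$; elements of $R$ are its rules. Write $x\to_T y$ if there exist $z,z'\in\Sigma^\star$ and $(s,t)\in R$ with $x=zsz'$ and $y=ztz'$; $\to_T^\star$ is the reflexive-transitive closure of $\to_T$. $\mathrm{ACCESSIBILITY}(k)$: given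 a semi-Thue system $T$ with exactly $k$ rules and two words $u,v$ over the alphabet of $T$, decide whether $u\to_T^\star v$. Decidable means algorithmically decidable (computable) under the obvious finite encodings of instances; "decidable on a class of instances" refers to the problem restricted to instances in that class. -}

module Defs where

open import Data.Bool.Base using (Bool; true; false)
open import Data.Fin.Base using (Fin; toℕ)
open import Data.List.Base using (List; []; _∷_; [_]; _++_; length; allFin)
open import Data.List.Membership.Propositional using (_∈_)
open import Data.List.Relation.Unary.Unique.Propositional using (Unique)
open import Data.Nat.Base using (ℕ; zero; suc)
open import Data.Product.Base using (_×_; _,_; ∃; ∃-syntax)
open import Level using (0ℓ)
open import Relation.Binary.Construct.Closure.ReflexiveTransitive using (Star)
open import Relation.Binary.Core using (Rel)
open import Relation.Binary.PropositionalEquality using (_≡_; _≢_; refl)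
open import Relation.Nullary.Decidable.Core using (Dec; does)
open import Relation.Unary using (Pred; U)

------------------------------------------------------------------------
-- Algorithms
--
-- Decidability below is decidability by a program, not merely inhabitation
-- of `Dec`.  The model of computation is Jones' one-variable WHILE language
-- over binary trees ("Computability and Complexity", MIT Press 1997), which
-- is Turing complete.  A program transforms the single stored tree.

infixr 5 _∙_

data Tree : Set where
  nil : Tree
  _∙_ : Tree → Tree → Tree

infixr 4 _⨾_

data Program : Set where
  skip nil hd tl : Program
  cons           : Program → Program → Program
  _⨾_            : Program → Program → Program
  if_then_else_  : Program → Program → Program → Program
  while_loop_    : Program → Program → Program

head tail : Tree → Tree
head nil     = nil
head (x ∙ y) = x
tail nil     = nil
tail (x ∙ y) = y

-- `p ⟨ x ⟩⇓ y`: started on x, the program p halts with result y.  A test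
-- succeeds when its value is not nil; evaluating it leaves the store as is.

infix 3 _⟨_⟩⇓_

data _⟨_⟩⇓_ : Program → Tree → Tree → Set where
  ⇓skip  : ∀ {x} → skip ⟨ x ⟩⇓ x
  ⇓nil   : ∀ {x} → nil ⟨ x ⟩⇓ nil
  ⇓hd    : ∀ {x} → hd ⟨ x ⟩⇓ head x
  ⇓tl    : ∀ {x} → tl ⟨ x ⟩⇓ tail x
  ⇓cons  : ∀ {p q x y z} → p ⟨ x ⟩⇓ y → q ⟨ x ⟩⇓ z → cons p q ⟨ x ⟩⇓ y ∙ z
  ⇓⨾     : ∀ {p q x y z} → p ⟨ x ⟩⇓ y → q ⟨ y ⟩⇓ z → p ⨾ q ⟨ x ⟩⇓ z
  ⇓then  : ∀ {c p q x a b y} → c ⟨ x ⟩⇓ a ∙ b → p ⟨ x ⟩⇓ y →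
           if c then p else q ⟨ x ⟩⇓ y
  ⇓else  : ∀ {c p q x y} → c ⟨ x ⟩⇓ nil → q ⟨ x ⟩⇓ y →
           if c then p else q ⟨ x ⟩⇓ y
  ⇓again : ∀ {c p x a b y z} → c ⟨ x ⟩⇓ a ∙ b → p ⟨ x ⟩⇓ y →
           while c loop p ⟨ y ⟩⇓ z → while c loop p ⟨ x ⟩⇓ z
  ⇓exit  : ∀ {c p x} → c ⟨ x ⟩⇓ nil → while c loop p ⟨ x ⟩⇓ x

⇓-deterministic : ∀ {p x y z} → p ⟨ x ⟩⇓ y → p ⟨ x ⟩⇓ z → y ≡ z
⇓-deterministic ⇓skip ⇓skip = refl
⇓-deterministic ⇓nil ⇓nil = refl
⇓-deterministic ⇓hd ⇓hd = refl
⇓-deterministic ⇓tl ⇓tl = refl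
⇓-deterministic (⇓cons d e) (⇓cons d′ e′)
  with refl ← ⇓-deterministic d d′ | refl ← ⇓-deterministic e e′ = refl
⇓-deterministic (⇓⨾ d e) (⇓⨾ d′ e′)
  with refl ← ⇓-deterministic d d′ = ⇓-deterministic e e′
⇓-deterministic (⇓then c d) (⇓then c′ d′) = ⇓-deterministic d d′
⇓-deterministic (⇓then c d) (⇓else c′ d′) with () ← ⇓-deterministic c c′
⇓-deterministic (⇓else c d) (⇓then c′ d′) with () ← ⇓-deterministic c c′
⇓-deterministic (⇓else c d) (⇓else c′ d′) = ⇓-deterministic d d′
⇓-deterministic (⇓again c d e) (⇓again c′ d′ e′)
  with refl ← ⇓-deterministic d d′ = ⇓-deterministic e e′
⇓-deterministic (⇓again c d e) (⇓exit c′) with () ← ⇓-deterministic c c′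
⇓-deterministic (⇓exit c) (⇓again c′ d′ e′) with () ← ⇓-deterministic c c′
⇓-deterministic (⇓exit c) (⇓exit c′) = refl

------------------------------------------------------------------------
-- Decision problems

record Problem : Set₁ where
  field
    Instance : Set
    encode   : Instance → Tree
    Yes      : Instance → Set

encodeBool : Bool → Tree
encodeBool false = nil
encodeBool true  = nil ∙ nil

-- On codes of instances outside C nothing is required of the program, not
-- even that it halts.

DecidableOn : (P : Problem) → Pred (Problem.Instance P) 0ℓ → Set
DecidableOn P C =
  ∃[ p ] ∀ I → C I → ∃ λ (d : Dec (Yes I)) → p ⟨ encode I ⟩⇓ encodeBool (does d)
  where open Problem P

Decidable : Problem → Set
Decidable P = DecidableOn P U

------------------------------------------------------------------------
-- Words and morphisms.  The alphabet with n letters is Fin n; in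
-- particular {0,1} is Fin 2.

Word : ℕ → Set
Word n = List (Fin n)

record Morphism (m n : ℕ) : Set where
  field
    ⟦_⟧  : Word m → Word n
    homo : ∀ x y → ⟦ x ++ y ⟧ ≡ ⟦ x ⟧ ++ ⟦ y ⟧

open Morphism public using (⟦_⟧)

encodeℕ : ℕ → Tree
encodeℕ zero    = nil
encodeℕ (suc n) = nil ∙ encodeℕ n

encodeList : {A : Set} → (A → Tree) → List A → Tree
encodeList f []       = nil
encodeList f (x ∷ xs) = f x ∙ encodeList f xs

encodeWord : ∀ {n} → Word n → Tree
encodeWord = encodeList (λ a → encodeℕ (toℕ a))

encodeMorphism : ∀ {m n} → Morphism m n → Tree
encodeMorphism {m} σ = encodeList (λ a → encodeWord (⟦ σ ⟧ [ a ])) (allFin m)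

------------------------------------------------------------------------
-- The generalized Post correspondence problem

record GPCPInstance (k : ℕ) : Set where
  field
    σ τ       : Morphism k 2
    s t s′ t′ : Word 2

ErasementFree : ∀ {k} → GPCPInstance k → Set
ErasementFree I = ∀ a → ⟦ σ ⟧ [ a ] ≢ [] × ⟦ τ ⟧ [ a ] ≢ []
  where open GPCPInstance I

GPCP : ℕ → Problem
GPCP k = record
  { Instance = GPCPInstance k
  ; encode   = λ I → let open GPCPInstance I in
      encodeℕ k ∙ encodeMorphism σ ∙ encodeMorphism τ ∙
      encodeWord s ∙ encodeWord t ∙ encodeWord s′ ∙ encodeWord t′
  ; Yes      = λ I → let open GPCPInstance I in
      ∃[ w ] s ++ ⟦ σ ⟧ w ++ t ≡ s′ ++ ⟦ τ ⟧ w ++ t′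
  }

------------------------------------------------------------------------
-- Semi-Thue systems.  Only finite rule sets occur in instances, so a rule
-- set is represented by a repetition-free list of its elements; the number
-- of rules is then the length of the list.

record SemiThue : Set where
  field
    size     : ℕ
    rules    : List (Word size × Word size)
    distinct : Unique rules

  Step : Rel (Word size) 0ℓ
  Step x y = ∃[ z ] ∃[ z′ ] ∃[ s ] ∃[ t ]
    (s , t) ∈ rules × x ≡ z ++ s ++ z′ × y ≡ z ++ t ++ z′

  Steps : Rel (Word size) 0ℓ
  Steps = Star Step

record AccessibilityInstance (k : ℕ) : Set where
  field
    T : SemiThue
  open SemiThue T public
  field
    #rules : length rules ≡ k
    u v    : Word size

encodeRule : ∀ {n} → Word n × Word n → Tree
encodeRule (s , t) = encodeWord s ∙ encodeWord t

ACCESSIBILITY : ℕ → Problem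
ACCESSIBILITY k = record
  { Instance = AccessibilityInstance k
  ; encode   = λ I → let open AccessibilityInstance I in
      encodeℕ size ∙ encodeList encodeRule rules ∙ encodeWord u ∙ encodeWord v
  ; Yes      = λ I → let open AccessibilityInstance I in Steps u v
  }

{-# OPTIONS --safe #-}
module Submission where

-- A word a₁ … aₘ is coded in binary as 0 1^(a₁+1) 0 … 0 1^(aₘ+1) 0.  Codes are
-- nonempty, begin and end with 0 and do not contain 00, and the occurrences
-- of code s in code x are exactly those of s in x.  A derivation
-- u = x₀ → … → xₘ = v gives a solution w of code u · σ(w) = τ(w) · code v in
-- which τ(w) spells code x₀ ⋯ code xₘ₋₁ and σ(w) spells code x₁ ⋯ code xₘ:
-- one letter per rule (τ its left, σ its right side) and two letters copying
-- the bits.  Conversely, in a solution the factor 00 marks the end of each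
-- code, so the code of the current word is consumed by whole letters, which
-- rewrite it into the code of a successor; a cut in the middle of the last
-- code would make 00 appear inside code v.

open import Data.Empty using (⊥-elim)
open import Data.Fin.Base using (Fin; zero; suc; toℕ)
open import Data.Fin.Patterns using (0F; 1F)
open import Data.Fin.Properties using (toℕ-injective)
open import Data.List.Base
  using (List; []; _∷_; [_]; _++_; _ʳ++_; reverse; length; lookup; concatMap; replicate; tabulate)
open import Data.List.Membership.Propositional.Properties using (∈-lookup)
open import Data.List.Properties
  using (++-assoc; ++-identityʳ; ++-cancelˡ; ∷-injectiveʳ; concatMap-++; reverse-involutive)
open import Data.List.Relation.Unary.Any using (index)
open import Data.List.Relation.Unary.Any.Properties using (lookup-index)
open import Data.Nat using (ℕ; zero; suc; _+_; _≤_; _<_)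
open import Data.Nat.Induction using (<-wellFounded)
open import Data.Nat.Properties using (suc-injective; +-comm; ≤-refl; m<n⇒m<1+n)
open import Data.Product.Base using (_×_; _,_; ∃; ∃-syntax; proj₁; proj₂)
open import Data.Sum.Base using (_⊎_; inj₁; inj₂)
open import Function.Base using (_∘_)
open import Induction.WellFounded using (Acc; acc)
open import Relation.Binary.Construct.Closure.ReflexiveTransitive using (ε; _◅_; _◅◅_; gmap)
open import Relation.Binary.PropositionalEquality
  using (_≡_; _≢_; refl; sym; trans; cong; cong₂; subst; module ≡-Reasoning)
open import Relation.Nullary.Decidable.Core using (Dec; does; map′)
open import Relation.Unary using (U)
open import Defs

open ≡-Reasoning

-- Binary codes of words.

ones : ℕ → Word 2
ones i = replicate i 1F

blocks : ∀ {n} → Word n → Word 2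
blocks []      = []
blocks (a ∷ x) = ones (suc (toℕ a)) ++ 0F ∷ blocks x

code : ∀ {n} → Word n → Word 2
code x = 0F ∷ blocks x

ones-cancel : ∀ i j {p q : Word 2} → ones i ++ 0F ∷ p ≡ ones j ++ 0F ∷ q → i ≡ j × p ≡ q
ones-cancel zero    zero    refl = refl , refl
ones-cancel (suc i) (suc j) eq   with refl , p≡q ← ones-cancel i j (∷-injectiveʳ eq) = refl , p≡q

ones-snoc : ∀ i (p : Word 2) → ones i ++ 1F ∷ p ≡ 1F ∷ ones i ++ p
ones-snoc zero    p = refl
ones-snoc (suc i) p = cong (1F ∷_) (ones-snoc i p)

code-++ : ∀ {n} (x y : Word n) → code (x ++ y) ≡ code x ++ blocks y
code-++ []      y = refl
code-++ (a ∷ x) y = cong (0F ∷_) (trans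
  (cong (ones (suc (toℕ a)) ++_) (code-++ x y))
  (sym (++-assoc (ones (suc (toℕ a))) (code x) (blocks y))))

code-++-∷ : ∀ {n} (s : Word n) a x p →
  code s ++ ones (suc (toℕ a)) ++ code x ++ p ≡ code (s ++ a ∷ x) ++ p
code-++-∷ s a x p = begin
  code s ++ ones (suc (toℕ a)) ++ code x ++ p
    ≡⟨ cong (code s ++_) (++-assoc (ones (suc (toℕ a))) (code x) p) ⟨
  code s ++ blocks (a ∷ x) ++ p
    ≡⟨ ++-assoc (code s) (blocks (a ∷ x)) p ⟨
  (code s ++ blocks (a ∷ x)) ++ p
    ≡⟨ cong (_++ p) (code-++ s (a ∷ x)) ⟨
  code (s ++ a ∷ x) ++ p ∎

-- The codes agree block by block. If `s` outran `x`, its code would have a 1 where the 0 behind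
-- `code x` stands. The 0 that ends `code s` also begins `code x′`, hence `0F ∷ p`.
code-prefix : ∀ {n} (s x : Word n) {p ρ} → code s ++ p ≡ code x ++ 0F ∷ ρ →
  ∃[ x′ ] x ≡ s ++ x′ × 0F ∷ p ≡ code x′ ++ 0F ∷ ρ
code-prefix []      x       eq = x , refl , eq
code-prefix (a ∷ s) (b ∷ x) {p} {ρ} eq
  with i≡j , tails ← ones-cancel (suc (toℕ a)) (suc (toℕ b)) (begin
         ones (suc (toℕ a)) ++ code s ++ p
           ≡⟨ ++-assoc (ones (suc (toℕ a))) (code s) p ⟨
         blocks (a ∷ s) ++ p
           ≡⟨ ∷-injectiveʳ eq ⟩
         blocks (b ∷ x) ++ 0F ∷ ρ
           ≡⟨ ++-assoc (ones (suc (toℕ b))) (code x) (0F ∷ ρ) ⟩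
         ones (suc (toℕ b)) ++ code x ++ 0F ∷ ρ ∎)
  with refl ← toℕ-injective (suc-injective i≡j)
  with x′ , refl , eq′ ← code-prefix s x (cong (0F ∷_) tails)
  = x′ , refl , eq′

code-injective : ∀ {n} {x y : Word n} → code x ≡ code y → x ≡ y
-- The appended 0 is the one that `code-prefix` expects behind a code; a nonempty remainder would
-- put a 1 in its place.
code-injective {x = x} {y} eq with code-prefix x y (cong (_++ [ 0F ]) eq)
... | []    , y≡x++[] , _ = sym (trans y≡x++[] (++-identityʳ x))
... | _ ∷ _ , _       , ()

-- Every nonempty suffix of a code has the form `ones j ++ code x`, so the induction can strip one
-- bit at a time.
no-00 : ∀ {n} j (x : Word n) r {q} → ones j ++ code x ≢ r ++ 0F ∷ 0F ∷ q
no-00 zero    []      (_ ∷ [])    ()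
no-00 zero    []      (_ ∷ _ ∷ _) ()
no-00 zero    (a ∷ x) (_ ∷ r)     eq = no-00 (suc (toℕ a)) x r (∷-injectiveʳ eq)
no-00 (suc j) x       (_ ∷ r)     eq = no-00 j x r (∷-injectiveʳ eq)

ends-in-0 : ∀ {n} j (x : Word n) → ∃[ r ] r ++ [ 0F ] ≡ ones j ++ code x
ends-in-0 (suc j) x       with r , eq ← ends-in-0 j x = 1F ∷ r , cong (1F ∷_) eq
ends-in-0 zero    []      = [] , refl
ends-in-0 zero    (a ∷ x) with r , eq ← ends-in-0 (suc (toℕ a)) x = 0F ∷ r , cong (0F ∷_) eq

-- The GPCP instance of a semi-Thue system.

Rule : ℕ → Set
Rule n = Word n × Word n

Side : ℕ → Set
Side n = Rule n → Word n

-- Letter 0 copies the bit 1; the others stand for the rules together with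
-- (ε , ε), whose letter copies the bit 0 because code [] is the word 0.
image : ∀ {n} (R : List (Rule n)) → Side n → Fin (2 + length R) → Word 2
image R side zero    = [ 1F ]
image R side (suc i) = code (side (lookup (([] , []) ∷ R) i))

image-≢[] : ∀ {n} (R : List (Rule n)) side a → image R side a ++ [] ≢ []
image-≢[] R side zero    ()
image-≢[] R side (suc i) ()

morphism : ∀ {n} (R : List (Rule n)) → Side n → Morphism (2 + length R) 2
morphism R side = record
  { ⟦_⟧  = concatMap (image R side)
  ; homo = concatMap-++ (image R side)
  }

module _ (T : SemiThue) where
  open SemiThue T

  Tiles : Set
  Tiles = Word (2 + length rules)

  bot top : Tiles → Word 2
  bot = ⟦ morphism rules proj₁ ⟧
  top = ⟦ morphism rules proj₂ ⟧

  lhs rhs : Fin (suc (length rules)) → Word size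
  lhs i = proj₁ (lookup (([] , []) ∷ rules) i)
  rhs i = proj₂ (lookup (([] , []) ∷ rules) i)

  instanceOf : Word size → Word size → GPCPInstance (2 + length rules)
  instanceOf u v = record
    { σ  = morphism rules proj₂
    ; τ  = morphism rules proj₁
    ; s  = code u
    ; t  = []
    ; s′ = []
    ; t′ = code v
    }

  instanceOf-erasementFree : ∀ u v → ErasementFree (instanceOf u v)
  instanceOf-erasementFree u v a = image-≢[] rules proj₂ a , image-≢[] rules proj₁ a

  -- From solutions to derivations.

  step-++ˡ : ∀ {x y} z → Step x y → Step (z ++ x) (z ++ y)
  step-++ˡ z (z₁ , z₂ , s , t , m , refl , refl) =
    z ++ z₁ , z₂ , s , t , m , sym (++-assoc z z₁ _) , sym (++-assoc z z₁ _)

  lhs⇒rhs : ∀ i z → Steps (lhs i ++ z) (rhs i ++ z)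
  lhs⇒rhs zero    z = ε
  lhs⇒rhs (suc i) z = ([] , z , lhs (suc i) , rhs (suc i) , ∈-lookup i , refl , refl) ◅ ε

  -- `ones j` is what is left of a block when the earlier tiles end inside it. Codes begin with 0,
  -- so only the tile copying 1 can cover these bits, and they reappear unchanged in `top-w`. The
  -- field `shorter` makes `match⇒steps` terminate.
  record Cut (w : Tiles) (j : ℕ) (x : Word size) : Set where
    constructor mkCut
    field
      rest    : Tiles
      y       : Word size
      shorter : length rest < length w
      bot-w   : bot w ≡ ones j ++ code x ++ bot rest
      top-w   : top w ≡ ones j ++ code y ++ top rest
      x⇒y     : Steps x y

  -- A code contains no 00, so no tile straddles the boundary between
  -- code x and the 0 behind it.
  cut : ∀ w j x {q ρ} → bot w ++ q ≡ ones j ++ code x ++ 0F ∷ ρ →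
        Cut w j x ⊎ (∃[ r ] bot w ++ r ++ [ 0F ] ≡ ones j ++ code x)
  -- When the tiles run out, the uncovered rest of the code is nonempty and ends in 0.
  cut []          j       x eq = inj₂ (ends-in-0 j x)
  cut (zero  ∷ w) (suc j) x eq with cut w j x (∷-injectiveʳ eq)
  ... | inj₂ (r , e) = inj₂ (r , cong (1F ∷_) e)
  ... | inj₁ (mkCut w₂ y lt b t x⇒y) =
    inj₁ (mkCut w₂ y (m<n⇒m<1+n lt) (cong (1F ∷_) b) (cong (1F ∷_) t) x⇒y)
  cut (suc i ∷ w) zero    x {q} {ρ} eq
    with code-prefix (lhs i) x (trans (sym (++-assoc (code (lhs i)) (bot w) q)) eq)
  ... | [] , refl , _ = inj₁ (mkCut w (rhs i ++ []) ≤-refl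
          (cong (λ z → code z ++ bot w) (sym (++-identityʳ (lhs i))))
          (cong (λ z → code z ++ top w) (sym (++-identityʳ (rhs i))))
          (lhs⇒rhs i []))
  ... | a ∷ x′ , refl , eq′
    -- Of `code (a ∷ x′)` the tile has already covered the first 0, so the next tile starts at the
    -- block of `a`.
    with cut w (suc (toℕ a)) x′
           (trans (∷-injectiveʳ eq′) (++-assoc (ones (suc (toℕ a))) (code x′) (0F ∷ ρ)))
  ... | inj₂ (r , e) = inj₂ (r , (begin
          (code (lhs i) ++ bot w) ++ r ++ [ 0F ]  ≡⟨ ++-assoc (code (lhs i)) (bot w) _ ⟩
          code (lhs i) ++ bot w ++ r ++ [ 0F ]    ≡⟨ cong (code (lhs i) ++_) e ⟩
          code (lhs i) ++ blocks (a ∷ x′)         ≡⟨ code-++ (lhs i) (a ∷ x′) ⟨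
          code (lhs i ++ a ∷ x′)                  ∎))
  ... | inj₁ (mkCut w₂ y lt b t x′⇒y) = inj₁ (mkCut w₂ (rhs i ++ a ∷ y) (m<n⇒m<1+n lt)
          (trans (cong (code (lhs i) ++_) b) (code-++-∷ (lhs i) a x′ (bot w₂)))
          (trans (cong (code (rhs i) ++_) t) (code-++-∷ (rhs i) a y (top w₂)))
          (lhs⇒rhs i (a ∷ x′) ◅◅ gmap (λ z → rhs i ++ a ∷ z) step x′⇒y))
    where
    step : ∀ {x y} → Step x y → Step (rhs i ++ a ∷ x) (rhs i ++ a ∷ y)
    step = step-++ˡ (rhs i) ∘ step-++ˡ [ a ]

  match⇒steps : ∀ {v} w → Acc _<_ (length w) → ∀ x →
                code x ++ top w ≡ bot w ++ code v → Steps x v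
  match⇒steps {v} [] _ x eq
    with refl ← code-injective {x = x} {v} (trans (sym (++-identityʳ (code x))) eq) = ε
  -- The first tile cannot copy 1, since `code x` begins with 0. Hence `top w` begins with a code
  -- and supplies the 0 that `cut` expects behind `code x`.
  match⇒steps {v} w@(suc _ ∷ _) (acc rec) x eq with cut w 0 x (sym eq)
  ... | inj₁ (mkCut w₂ y lt b t x⇒y) = x⇒y ◅◅ match⇒steps w₂ (rec lt) y
          (++-cancelˡ (code x) _ _ (begin
            code x ++ code y ++ top w₂      ≡⟨ cong (code x ++_) t ⟨
            code x ++ top w                 ≡⟨ eq ⟩
            bot w ++ code v                 ≡⟨ cong (_++ code v) b ⟩
            (code x ++ bot w₂) ++ code v    ≡⟨ ++-assoc (code x) (bot w₂) (code v) ⟩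
            code x ++ bot w₂ ++ code v      ∎))
  -- If the tiles end inside `code x`, its last 0 and the first 0 of `top w` are adjacent in
  -- `code v`.
  ... | inj₂ (r , e) = ⊥-elim (no-00 0 v r (++-cancelˡ (bot w) _ _ (begin
            bot w ++ code v                 ≡⟨ eq ⟨
            code x ++ top w                 ≡⟨ cong (_++ top w) e ⟨
            (bot w ++ r ++ [ 0F ]) ++ top w ≡⟨ ++-assoc (bot w) (r ++ [ 0F ]) (top w) ⟩
            bot w ++ (r ++ [ 0F ]) ++ top w ≡⟨ cong (bot w ++_) (++-assoc r [ 0F ] (top w)) ⟩
            bot w ++ r ++ 0F ∷ top w        ∎)))

  -- From derivations to solutions.

  copy : Word 2 → Tiles
  copy []       = []
  -- The names cross over: tile 1 is (ε , ε) with code 0, and tile 0 copies the bit 1.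
  copy (0F ∷ b) = 1F ∷ copy b
  copy (1F ∷ b) = 0F ∷ copy b

  copy-image : ∀ (side : Side size) → side ([] , []) ≡ [] → ∀ b w →
    ⟦ morphism rules side ⟧ (copy b ++ w) ≡ b ++ ⟦ morphism rules side ⟧ w
  copy-image side ε↦ε []       w = refl
  copy-image side ε↦ε (0F ∷ b) w = cong₂ _++_ (cong code ε↦ε) (copy-image side ε↦ε b w)
  copy-image side ε↦ε (1F ∷ b) w = cong (1F ∷_) (copy-image side ε↦ε b w)

  copy-code : ∀ (side : Side size) → side ([] , []) ≡ [] → ∀ (s z : Word size) →
    code s ++ ⟦ morphism rules side ⟧ (copy (blocks z)) ≡ code (s ++ z)
  copy-code side ε↦ε s z = begin
    code s ++ ⟦ morphism rules side ⟧ (copy (blocks z))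
      ≡⟨ cong (λ w → code s ++ ⟦ morphism rules side ⟧ w) (++-identityʳ (copy (blocks z))) ⟨
    code s ++ ⟦ morphism rules side ⟧ (copy (blocks z) ++ [])
      ≡⟨ cong (code s ++_) (copy-image side ε↦ε (blocks z) []) ⟩
    code s ++ blocks z ++ []
      ≡⟨ cong (code s ++_) (++-identityʳ (blocks z)) ⟩
    code s ++ blocks z
      ≡⟨ code-++ s z ⟨
    code (s ++ z) ∎

  -- Each letter before the redex is copied together with the 0 preceding it. The rule tile brings
  -- both of its outer 0s, so behind it only `blocks z` remains to be copied.
  step⇒tiles : ∀ {x y} → Step x y → ∃[ w ] bot w ≡ code x × top w ≡ code y
  step⇒tiles ([] , z , s , t , m , refl , refl) =
    -- The shift by two skips the copying tiles.
    suc (suc (index m)) ∷ copy (blocks z) ,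
    trans (cong (λ r → code (proj₁ r) ++ bot (copy (blocks z))) (sym (lookup-index m)))
          (copy-code proj₁ refl s z) ,
    trans (cong (λ r → code (proj₂ r) ++ top (copy (blocks z))) (sym (lookup-index m)))
          (copy-code proj₂ refl t z)
  step⇒tiles (a ∷ z₁ , z₂ , s , t , m , refl , refl)
    with w , bot-w , top-w ← step⇒tiles (z₁ , z₂ , s , t , m , refl , refl) =
    copy b ++ w ,
    trans (copy-image proj₁ refl b w) (cong (b ++_) bot-w) ,
    trans (copy-image proj₂ refl b w) (cong (b ++_) top-w)
    where
    b : Word 2
    b = 0F ∷ ones (suc (toℕ a))

  -- The tiles of the first step consume `code u` and leave `code x` as the overhang that the
  -- remaining steps start from.
  steps⇒match : ∀ {u v} → Steps u v → ∃[ w ] code u ++ top w ≡ bot w ++ code v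
  steps⇒match {v = v} ε = [] , ++-identityʳ (code v)
  steps⇒match {u} {v} (_◅_ {j = x} st sts)
    with w₁ , b , t ← step⇒tiles st | w₂ , eq ← steps⇒match sts = w₁ ++ w₂ , (begin
      code u ++ top (w₁ ++ w₂)        ≡⟨ cong (code u ++_) (concatMap-++ _ w₁ w₂) ⟩
      code u ++ top w₁ ++ top w₂      ≡⟨ cong₂ _++_ (sym b) (cong (_++ top w₂) t) ⟩
      bot w₁ ++ code x ++ top w₂      ≡⟨ cong (bot w₁ ++_) eq ⟩
      bot w₁ ++ bot w₂ ++ code v      ≡⟨ ++-assoc (bot w₁) (bot w₂) (code v) ⟨
      (bot w₁ ++ bot w₂) ++ code v    ≡⟨ cong (_++ code v) (concatMap-++ _ w₁ w₂) ⟨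
      bot (w₁ ++ w₂) ++ code v        ∎)
  instanceOf-yes⇒steps : ∀ u v → Problem.Yes (GPCP _) (instanceOf u v) → Steps u v
  instanceOf-yes⇒steps u v (w , eq) = match⇒steps w (<-wellFounded _) u
    (trans (cong (code u ++_) (sym (++-identityʳ (top w)))) eq)

  steps⇒instanceOf-yes : ∀ u v → Steps u v → Problem.Yes (GPCP _) (instanceOf u v)
  steps⇒instanceOf-yes u v u⇒v with w , eq ← steps⇒match u⇒v =
    w , trans (cong (code u ++_) (++-identityʳ (top w))) eq

-- A WHILE program computing the reduction.

⇓-subst : ∀ {p x y z} → y ≡ z → p ⟨ x ⟩⇓ y → p ⟨ x ⟩⇓ z
⇓-subst refl p⇓ = p⇓

constant : Tree → Program
constant nil     = nil
constant (x ∙ y) = cons (constant x) (constant y)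

constant⇓ : ∀ t {x} → constant t ⟨ x ⟩⇓ t
constant⇓ nil     = ⇓nil
constant⇓ (t ∙ u) = ⇓cons (constant⇓ t) (constant⇓ u)

-- Output lists grow at the front, so a code is written from its last letter on and the word has to
-- be reversed first.
reverseLoop reverseProgram : Program
reverseLoop    = while hd loop cons (hd ⨾ tl) (cons (hd ⨾ hd) tl)
reverseProgram = cons skip nil ⨾ reverseLoop ⨾ tl

reverseLoop⇓ : ∀ {A : Set} {e : A → Tree} xs ys →
  reverseLoop ⟨ encodeList e xs ∙ encodeList e ys ⟩⇓ nil ∙ encodeList e (xs ʳ++ ys)
reverseLoop⇓ []       ys = ⇓exit ⇓hd
reverseLoop⇓ (x ∷ xs) ys =
  ⇓again ⇓hd (⇓cons (⇓⨾ ⇓hd ⇓tl) (⇓cons (⇓⨾ ⇓hd ⇓hd) ⇓tl)) (reverseLoop⇓ xs (x ∷ ys))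

reverseProgram⇓ : ∀ {A : Set} {e : A → Tree} xs →
  reverseProgram ⟨ encodeList e xs ⟩⇓ encodeList e (reverse xs)
reverseProgram⇓ xs = ⇓⨾ (⇓cons ⇓skip ⇓nil) (⇓⨾ (reverseLoop⇓ xs []) ⇓tl)

-- The store is (remaining word) ∙ (output); the unary numeral of the first
-- remaining letter is counted down in place.
codeLoop codeProgram : Program
codeLoop = while hd loop
  (if hd ⨾ hd
   then cons (cons (hd ⨾ hd ⨾ tl) (hd ⨾ tl)) (cons (constant (encodeℕ 1)) tl)
   else cons (hd ⨾ tl) (cons nil (cons (constant (encodeℕ 1)) tl)))
codeProgram = reverseProgram ⨾ cons skip (constant (encodeWord {2} [ 0F ])) ⨾ codeLoop ⨾ tl

codeLoop⇓ : ∀ {n} (x y : Word n) →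
  codeLoop ⟨ encodeWord x ∙ encodeWord (code y) ⟩⇓ nil ∙ encodeWord (code (x ʳ++ y))

-- Invariant inside a letter: `i` is the numeral still to be counted down and `c` the output so far.
-- The extra 1 is written together with the 0 once the numeral reaches zero.
codeLetter⇓ : ∀ {n} i (a : Fin n) (x y : Word n) c → ones i ++ 1F ∷ c ≡ blocks (a ∷ y) →
  codeLoop ⟨ (encodeℕ i ∙ encodeWord x) ∙ encodeWord c ⟩⇓ nil ∙ encodeWord (code (x ʳ++ a ∷ y))
codeLetter⇓ zero    a x y c refl =
  ⇓again ⇓hd (⇓else (⇓⨾ ⇓hd ⇓hd) (⇓cons (⇓⨾ ⇓hd ⇓tl) (⇓cons ⇓nil (⇓cons (constant⇓ _) ⇓tl))))
    (codeLoop⇓ x (a ∷ y))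
codeLetter⇓ (suc i) a x y c eq =
  ⇓again ⇓hd (⇓then (⇓⨾ ⇓hd ⇓hd)
      (⇓cons (⇓cons (⇓⨾ ⇓hd (⇓⨾ ⇓hd ⇓tl)) (⇓⨾ ⇓hd ⇓tl)) (⇓cons (constant⇓ _) ⇓tl)))
    (codeLetter⇓ i a x y (1F ∷ c) (trans (ones-snoc i (1F ∷ c)) eq))

codeLoop⇓ []      y = ⇓exit ⇓hd
codeLoop⇓ (a ∷ x) y = codeLetter⇓ (toℕ a) a x y (code y) (ones-snoc (toℕ a) (code y))

codeProgram⇓ : ∀ {n} (x : Word n) → codeProgram ⟨ encodeWord x ⟩⇓ encodeWord (code x)
codeProgram⇓ x = ⇓⨾ (reverseProgram⇓ x) (⇓⨾ (⇓cons ⇓skip (constant⇓ _)) (⇓⨾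
  (⇓-subst (cong (λ z → nil ∙ encodeWord (code z)) (reverse-involutive x))
    (codeLoop⇓ (reverse x) [])) ⇓tl))

-- The number of rules is fixed before the program is chosen, so the pass over the rules is
-- unrolled.
mapProgram : Program → ℕ → Program
mapProgram p zero    = nil
mapProgram p (suc k) = cons (hd ⨾ p) (tl ⨾ mapProgram p k)

mapProgram⇓ : ∀ {A : Set} {e f : A → Tree} {p} → (∀ x → p ⟨ e x ⟩⇓ f x) →
  ∀ xs → mapProgram p (length xs) ⟨ encodeList e xs ⟩⇓ encodeList f xs
mapProgram⇓ p⇓ []       = ⇓nil
mapProgram⇓ p⇓ (x ∷ xs) = ⇓cons (⇓⨾ ⇓hd (p⇓ x)) (⇓⨾ ⇓tl (mapProgram⇓ p⇓ xs))

-- Reconciles `encodeMorphism`, which enumerates letters by `allFin`, with the program, which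
-- traverses the rules.
encodeList-tabulate : ∀ {A B : Set} {f : A → Tree} {e : B → Tree} xs (g : Fin (length xs) → A) →
  (∀ i → f (g i) ≡ e (lookup xs i)) → encodeList f (tabulate g) ≡ encodeList e xs
encodeList-tabulate []       g eq = refl
encodeList-tabulate (x ∷ xs) g eq =
  cong₂ _∙_ (eq zero) (encodeList-tabulate xs (g ∘ suc) (eq ∘ suc))

encodeMorphism-morphism : ∀ {n} (R : List (Rule n)) side →
  encodeMorphism (morphism R side) ≡
  encodeWord {2} [ 1F ] ∙ encodeList (encodeWord ∘ code ∘ side) (([] , []) ∷ R)
encodeMorphism-morphism R side = cong (encodeWord {2} [ 1F ] ∙_)
  (encodeList-tabulate (([] , []) ∷ R) suc
    (λ i → cong encodeWord (++-identityʳ (image R side (suc i)))))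

morphismProgram : Program → ℕ → Program
morphismProgram sideProgram k =
  cons (constant (encodeWord {2} [ 1F ])) (cons (constant (encodeWord {2} [ 0F ]))
    (mapProgram (sideProgram ⨾ codeProgram) k))

morphismProgram⇓ : ∀ {n} (R : List (Rule n)) (side : Side n) {p} → side ([] , []) ≡ [] →
  (∀ r → p ⟨ encodeRule r ⟩⇓ encodeWord (side r)) →
  morphismProgram p (length R) ⟨ encodeList encodeRule R ⟩⇓ encodeMorphism (morphism R side)
morphismProgram⇓ R side {p} ε↦ε p⇓ = ⇓-subst
  (sym (encodeMorphism-morphism R side))
  (⇓cons (constant⇓ _) (⇓cons
    (⇓-subst (cong (encodeWord ∘ code) (sym ε↦ε)) (constant⇓ _))
    (mapProgram⇓ (λ r → ⇓⨾ (p⇓ r) (codeProgram⇓ (side r))) R)))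

reduction : ℕ → Program
reduction k =
  cons (constant (encodeℕ (2 + k)))
  (cons (rules ⨾ morphismProgram tl k)
  (cons (rules ⨾ morphismProgram hd k)
  (cons (tl ⨾ tl ⨾ hd ⨾ codeProgram)
  (cons nil
  (cons nil
  (tl ⨾ tl ⨾ tl ⨾ codeProgram))))))
  where rules = tl ⨾ hd

reduction⇓ : ∀ (T : SemiThue) u v → let open SemiThue T in
  reduction (length rules)
    ⟨ encodeℕ size ∙ encodeList encodeRule rules ∙ encodeWord u ∙ encodeWord v ⟩⇓
  Problem.encode (GPCP (2 + length rules)) (instanceOf T u v)
reduction⇓ T u v =
  ⇓cons (constant⇓ _)
  (⇓cons (⇓⨾ (⇓⨾ ⇓tl ⇓hd) (morphismProgram⇓ rules proj₂ refl (λ _ → ⇓tl)))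
  (⇓cons (⇓⨾ (⇓⨾ ⇓tl ⇓hd) (morphismProgram⇓ rules proj₁ refl (λ _ → ⇓hd)))
  (⇓cons (⇓⨾ ⇓tl (⇓⨾ ⇓tl (⇓⨾ ⇓hd (codeProgram⇓ u))))
  (⇓cons ⇓nil
  (⇓cons ⇓nil
  (⇓⨾ ⇓tl (⇓⨾ ⇓tl (⇓⨾ ⇓tl (codeProgram⇓ v)))))))))
  where open SemiThue T

theorem1 : (k : ℕ) → 1 ≤ k → DecidableOn (GPCP (k + 2)) ErasementFree → Decidable (ACCESSIBILITY k)
theorem1 k _ gpcp
  with p , p-decides ← subst (λ m → DecidableOn (GPCP m) ErasementFree) (+-comm k 2) gpcp =
  (reduction k ⨾ p) , decides
  where
  decides : ∀ I → U I → ∃ λ (d : Dec (Problem.Yes (ACCESSIBILITY k) I)) →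
    (reduction k ⨾ p) ⟨ Problem.encode (ACCESSIBILITY k) I ⟩⇓ encodeBool (does d)
  -- Matching `refl` turns `k` into `length rules`, the number of copies unrolled in `reduction`.
  decides record { T = T ; #rules = refl ; u = u ; v = v } _
    with d , halts ← p-decides (instanceOf T u v) (instanceOf-erasementFree T u v) =
    map′ (instanceOf-yes⇒steps T u v) (steps⇒instanceOf-yes T u v) d ,
    ⇓⨾ (reduction⇓ T u v) halts
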